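{- There is no non-trivial class of idempotent semifields that is finitely based. That is, if $\mathsf{K}$ is a class of idempotent semifields (algebras in the signature $\{\vee,\cdot,\mathrm{e}\}$) such that at least one member of $\mathsf{K}$ has more than one element, then the equational theory $\mathrm{Eq}(\mathsf{K})$ has no finite basis.
   Context: An idempotent semiring is an algebraic structure $\langle S,\vee,\cdot,\mathrm{e}\rangle$ such that $\langle S,\cdot,\mathrm{e}\rangle$ is a monoid, $\langle S,\vee\rangle$ is a semilattice (an idempotent commutative semigroup), and $a(b\vee c)d=abd\vee acd$ for all $a,b,c,d\in S$. It is called an idempotent semifield if $\langle S,\cdot,\mathrm{e}\rangle$ is the monoid reduct of a group (i.e., every element is invertible). The signature is $\{\vee,\cdot,\mathrm{e}\}$ (no inverse operation and no meet). For a signature $\mathcal{L}$, an $\mathcal{L}$-algebra is a non-empty set with an operation for each symbol of $\mathcal{L}$. $\mathcal{L}$-terms are built from a countably infinite set of variables; an $\mathcal{L}$-equation $s\approx t$ is an ordered pair of $\mathcal{L}$-terms, and it is satisfied by an $\mathcal{L}$-algebra $\mathbf{A}$ if $\varphi(s)=\varphi(t)$ for every homomorphism $\varphi$ from the $\mathcal{L}$-term algebra to $\mathbf{A}$. For a class $\mathsf{K}$ of $\mathcal{L}$-algebras, $\mathrm{Eq}(\mathsf{K})$ is the set of all $\mathcal{L}$-equations satisfied by all members of $\mathsf{K}$. A basis for $\mathrm{Eq}(\mathsf{K})$ is a set $\Sigma\subseteq\mathrm{Eq}(\mathsf{K})$ such that every $\mathcal{L}$-algebra satisfying all equations in $\Sigma$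 satisfies all equations in $\mathrm{Eq}(\mathsf{K})$. The class $\mathsf{K}$ is finitely based if $\mathrm{Eq}(\mathsf{K})$ has a finite basis, and non-trivial if at least one of its members has more than one element. -}

module Defs where

open import Algebra.Bundles.Raw using (RawMonoid)
open import Algebra.Core using (Op₂)
import Algebra.Definitions as Definitions
import Algebra.Lattice.Structures as LatticeStructures
open import Algebra.Morphism.Structures using (module MonoidMorphisms)
import Algebra.Structures as Structures
open import Data.List.Membership.Propositional using (_∈_)
open import Data.Nat.Base using (ℕ)
open import Data.Product.Base using (∃-syntax; _×_; _,_)
open import Level using (Level; _⊔_; suc; 0ℓ)
open import Relation.Binary.Core using (Rel)
open import Relation.Binary.PropositionalEquality using (_≡_; isEquivalence; cong₂)
open import Relation.Binary.Structures using (IsEquivalence)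
open import Relation.Nullary.Negation.Core using (¬_)
open import Relation.Unary using (Pred)

private
  variable
    c ℓ c′ ℓ′ k p : Level

-- Algebras in the signature {∨, ·, e}, with equality given by an equivalence
-- relation, as for the bundles of the standard library.  They are non-empty
-- since e is an element.
record L-Algebra c ℓ : Set (suc (c ⊔ ℓ)) where
  infix  4 _≈_
  infixl 6 _∨_
  infixl 7 _·_
  field
    Carrier       : Set c
    _≈_           : Rel Carrier ℓ
    _∨_           : Op₂ Carrier
    _·_           : Op₂ Carrier
    e             : Carrier
    ≈-equivalence : IsEquivalence _≈_
    ∨-cong        : Definitions.Congruent₂ _≈_ _∨_
    ·-cong        : Definitions.Congruent₂ _≈_ _·_

  ·-rawMonoid : RawMonoid c ℓ
  ·-rawMonoid = record { Carrier = Carrier ; _≈_ = _≈_ ; _∙_ = _·_ ; ε = e }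

record IsIdempotentSemiring (A : L-Algebra c ℓ) : Set (c ⊔ ℓ) where
  open L-Algebra A
  field
    ·-isMonoid      : Structures.IsMonoid _≈_ _·_ e
    ∨-isSemilattice : LatticeStructures.IsSemilattice _≈_ _∨_
    distrib         : ∀ a b c d → a · (b ∨ c) · d ≈ (a · b · d) ∨ (a · c · d)

record IsIdempotentSemifield (A : L-Algebra c ℓ) : Set (c ⊔ ℓ) where
  open L-Algebra A
  field
    isIdempotentSemiring : IsIdempotentSemiring A
    ·-isGroupReduct      : ∃[ inv ] Structures.IsGroup _≈_ _·_ e inv

record Homomorphism (A : L-Algebra c ℓ) (B : L-Algebra c′ ℓ′)
                    : Set (c ⊔ ℓ ⊔ c′ ⊔ ℓ′) where
  private
    module A = L-Algebra A
    module B = L-Algebra B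
  open MonoidMorphisms A.·-rawMonoid B.·-rawMonoid using (IsMonoidHomomorphism)
  field
    ⟦_⟧                  : A.Carrier → B.Carrier
    isMonoidHomomorphism : IsMonoidHomomorphism ⟦_⟧
    ∨-homo               : ∀ x y → ⟦ x A.∨ y ⟧ B.≈ ⟦ x ⟧ B.∨ ⟦ y ⟧

infixl 6 _∨ₜ_
infixl 7 _·ₜ_

data Term : Set where
  var  : ℕ → Term
  _∨ₜ_ : Term → Term → Term
  _·ₜ_ : Term → Term → Term
  eₜ   : Term

termAlgebra : L-Algebra 0ℓ 0ℓ
termAlgebra = record
  { Carrier       = Term
  ; _≈_           = _≡_
  ; _∨_           = _∨ₜ_
  ; _·_           = _·ₜ_
  ; e             = eₜ
  ; ≈-equivalence = isEquivalence
  ; ∨-cong        = cong₂ _∨ₜ_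
  ; ·-cong        = cong₂ _·ₜ_
  }

Equation : Set
Equation = Term × Term

infix 4 _⊨_

_⊨_ : L-Algebra c ℓ → Equation → Set (c ⊔ ℓ)
A ⊨ (s , t) = (φ : Homomorphism termAlgebra A) →
              let open Homomorphism φ in L-Algebra._≈_ A ⟦ s ⟧ ⟦ t ⟧

Eq : Pred (L-Algebra c ℓ) k → Pred Equation (suc (c ⊔ ℓ) ⊔ k)
Eq K ε = ∀ A → K A → A ⊨ ε

record IsBasis (K : Pred (L-Algebra c ℓ) k) (Σ : Pred Equation p)
               : Set (suc (c ⊔ ℓ) ⊔ k ⊔ p) where
  field
    sound    : ∀ ε → Σ ε → Eq K ε
    complete : (A : L-Algebra c ℓ) → (∀ ε → Σ ε → A ⊨ ε) → ∀ ε → Eq K ε → A ⊨ ε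

-- Finite sets of equations are those enumerated by a list.
FinitelyBased : Pred (L-Algebra c ℓ) k → Set (suc (c ⊔ ℓ) ⊔ k)
FinitelyBased K = ∃[ εs ] IsBasis K (λ ε → ε ∈ εs)

NonTrivial : Pred (L-Algebra c ℓ) k → Set (suc (c ⊔ ℓ) ⊔ k)
NonTrivial K = ∃[ A ] K A × (let open L-Algebra A in ∃[ x ] ∃[ y ] ¬ (x ≈ y))

{-# OPTIONS --safe #-}
module Submission where

-- Powers of an element a > e embed (ℤ, max, +) into any non-trivial idempotent
-- semifield, so every equation of Eq(K) holds in ℤ.  On the other hand every
-- idempotent semifield satisfies b ≤ e ∨ x₀b ∨ ⋯ ∨ xₙ₋₁b with b = xₙ₋₁⋯x₀:
-- multiplied by b⁻¹, the right-hand side is an element g above b⁻¹ and all xᵢ,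
-- so gⁿ⁺¹ ≥ e and hence g ≥ e.
--
-- Geometrically, the exponents on the right-hand side are the vertices of an
-- n-dimensional simplex whose only other lattice point is its barycentre, the
-- exponent of b.  Identifying terms whose sets of exponents have the same
-- translates inside the vertex set gives an algebra in which the inequality
-- fails, but which satisfies every equation of ℤ with at most n monomials: an
-- instance of such an equation meets the simplex in a proper face, and proper
-- faces have no lattice points besides their vertices.

open import Defs
open import Algebra.Bundles using (AbelianGroup; Group)
import Algebra.Definitions.RawMonoid as RawMonoidDefinitions
open import Algebra.Lattice.Bundles using (Semilattice)
import Algebra.Lattice.Properties.Semilattice as SemilatticeProperties
open import Algebra.Morphism.Structures using (module MonoidMorphisms)
import Algebra.Properties.Group as GroupProperties
open import Data.Fin.Base as Fin using (Fin; zero; suc; toℕ)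
import Data.Fin.Properties as Fin
open import Data.Integer.Base as ℤ using (ℤ; +_; -[1+_])
import Data.Integer.Properties as ℤ
open import Data.Integer.Tactic.RingSolver using (solve-∀)
open import Data.List.Base using (List; []; _∷_; _++_; map; length; lookup; cartesianProduct)
open import Data.List.Membership.Propositional using (_∈_; _∉_)
open import Data.List.Membership.Propositional.Properties
  using (∈-map⁺; ∈-++⁺ˡ; ∈-++⁺ʳ; ∈-cartesianProduct⁺)
import Data.List.Properties as List
import Data.List.Relation.Unary.All as All
open import Data.List.Relation.Unary.Any as Any using (here)
import Data.List.Relation.Unary.Any.Properties as Any
open import Data.Nat.Base as ℕ using (ℕ; zero; suc)
import Data.Nat.Properties as ℕ
open import Algebra.Properties.CommutativeMonoid.Sum ℤ.+-0-commutativeMonoid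
  using (sum; ∑-distrib-+; sum-cong-≗; sum-replicate-zero)
import Algebra.Properties.CommutativeMonoid.Sum ℕ.+-0-commutativeMonoid as ℕΣ
open import Data.List.Extrema ℕ.≤-totalOrder using (max; ⊥≤max; xs≤max)
open import Data.Product.Base using (∃; ∃-syntax; ∃₂; _×_; _,_; proj₁; proj₂)
open import Data.Sum.Base using (_⊎_; inj₁; inj₂)
open import Data.Unit.Base using (⊤; tt)
open import Function.Base using (_∘_)
open import Level using (Lift; lift; lower)
open import Relation.Binary.Definitions using (tri<; tri≈; tri>)
import Relation.Binary.Lattice as OrderLattice
open import Relation.Binary.PropositionalEquality as ≡
  using (_≡_; _≢_; refl; sym; trans; cong; cong₂; subst)
import Relation.Binary.Reasoning.PartialOrder as ≤-Reasoning
open import Relation.Binary.Structures using (module IsEquivalence)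
open import Relation.Nullary.Decidable using (yes; no; decidable-stable)
open import Relation.Nullary.Negation.Core using (¬_; contradiction)
open import Relation.Unary using (Pred)

-- Evaluation of terms, and the two sides of the inequality.

evalℤ : (ℕ → ℤ) → Term → ℤ
evalℤ φ (var i)  = φ i
evalℤ φ (s ∨ₜ t) = evalℤ φ s ℤ.⊔ evalℤ φ t
evalℤ φ (s ·ₜ t) = evalℤ φ s ℤ.+ evalℤ φ t
evalℤ φ eₜ       = + 0

eval : ∀ {c ℓ} (A : L-Algebra c ℓ) → (ℕ → L-Algebra.Carrier A) → Term → L-Algebra.Carrier A
eval A φ (var i)  = φ i
eval A φ (s ∨ₜ t) = let open L-Algebra A in eval A φ s ∨ eval A φ t
eval A φ (s ·ₜ t) = let open L-Algebra A in eval A φ s · eval A φ t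
eval A φ eₜ       = L-Algebra.e A

evalHomomorphism : ∀ {c ℓ} (A : L-Algebra c ℓ) → (ℕ → L-Algebra.Carrier A) → Homomorphism termAlgebra A
evalHomomorphism A φ = record
  { ⟦_⟧ = eval A φ
  ; isMonoidHomomorphism = record
    { isMagmaHomomorphism = record
      { isRelHomomorphism = record { cong = λ { refl → A.refl } }
      ; homo = λ _ _ → A.refl }
    ; ε-homo = A.refl }
  ; ∨-homo = λ _ _ → A.refl }
  where module A = IsEquivalence (L-Algebra.≈-equivalence A)

varProduct : ℕ → Term
varProduct zero    = eₜ
varProduct (suc n) = var n ·ₜ varProduct n

-- `b` is a parameter, so that recursion on the number of summands leaves the product
-- `b = varProduct n` fixed.
varMultiples : ℕ → Term → Term
varMultiples zero    b = eₜ
varMultiples (suc n) b = varMultiples n b ∨ₜ (var n ·ₜ b)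

-- Order and powers in an idempotent semifield.

module Semifield {c ℓ} {A : L-Algebra c ℓ} (isSemifield : IsIdempotentSemifield A) where
  open L-Algebra A public
  open IsIdempotentSemifield isSemifield
  open IsIdempotentSemiring isIdempotentSemiring

  group : Group c ℓ
  group = record { isGroup = proj₂ ·-isGroupReduct }

  open Group group public
    using (_⁻¹; assoc; identityˡ; identityʳ; inverseˡ; inverseʳ)
    renaming
      ( refl to ≈-refl; sym to ≈-sym; reflexive to ≈-reflexive; trans to ≈-trans
      ; ∙-congˡ to ·-congˡ; ∙-congʳ to ·-congʳ )
  open GroupProperties group public
  open RawMonoidDefinitions ·-rawMonoid public using () renaming (_×_ to _×ₙ_)

  ∨-semilattice : Semilattice c ℓ
  ∨-semilattice = record { isSemilattice = ∨-isSemilattice }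

  open OrderLattice.JoinSemilattice
    (SemilatticeProperties.∧-orderTheoreticJoinSemilattice ∨-semilattice) public
    using (_≤_; x≤x∨y; y≤x∨y; ∨-least; antisym; poset)
    renaming (refl to ≤-refl; trans to ≤-trans; reflexive to ≤-reflexive)

  open ≤-Reasoning poset public

  distribˡ : ∀ a b c → a · (b ∨ c) ≈ a · b ∨ a · c
  distribˡ a b c = ≈-trans (≈-sym (identityʳ _))
    (≈-trans (distrib a b c e) (∨-cong (identityʳ _) (identityʳ _)))

  distribʳ : ∀ a b c → (b ∨ c) · a ≈ b · a ∨ c · a
  distribʳ a b c = ≈-trans (·-congʳ (≈-sym (identityˡ _)))
    (≈-trans (distrib e b c a) (∨-cong (·-congʳ (identityˡ _)) (·-congʳ (identityˡ _))))

  -- x ≤ y unfolds to y ≈ y ∨ x.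
  ·-monoˡ : ∀ a {x y} → x ≤ y → a · x ≤ a · y
  ·-monoˡ a {x} {y} x≤y = ≈-trans (·-congˡ x≤y) (distribˡ a y x)

  ·-monoʳ : ∀ a {x y} → x ≤ y → x · a ≤ y · a
  ·-monoʳ a {x} {y} x≤y = ≈-trans (·-congʳ x≤y) (distribʳ a y x)

  ·-mono : ∀ {x y u v} → x ≤ y → u ≤ v → x · u ≤ y · v
  ·-mono {x} {y} {u} {v} x≤y u≤v = ≤-trans (·-monoʳ u x≤y) (·-monoˡ y u≤v)

  yx≤z⇒y≤zx⁻¹ : ∀ {x y z} → y · x ≤ z → y ≤ z · x ⁻¹
  yx≤z⇒y≤zx⁻¹ {x} {y} {z} yx≤z = begin
    y              ≈⟨ //-rightDividesʳ x y ⟨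
    y · x · x ⁻¹   ≤⟨ ·-monoʳ (x ⁻¹) yx≤z ⟩
    z · x ⁻¹       ∎

  x≤yx⇒e≤y : ∀ {x y} → x ≤ y · x → e ≤ y
  x≤yx⇒e≤y {x} {y} x≤yx = begin
    e             ≈⟨ inverseʳ x ⟨
    x · x ⁻¹      ≤⟨ ·-monoʳ (x ⁻¹) x≤yx ⟩
    y · x · x ⁻¹  ≈⟨ //-rightDividesʳ x y ⟩
    y             ∎

  -- Horner form of e ∨ g ∨ ⋯ ∨ gⁿ, which makes monotonicity of multiplication by `g` suffice in the
  -- inductions below.
  powerJoin : Carrier → ℕ → Carrier
  powerJoin g zero    = e
  powerJoin g (suc n) = e ∨ g · powerJoin g n

  power≤powerJoin : ∀ g n → n ×ₙ g ≤ powerJoin g n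
  power≤powerJoin g zero    = ≤-refl
  power≤powerJoin g (suc n) = ≤-trans (·-monoˡ g (power≤powerJoin g n)) (y≤x∨y _ _)

  powerJoin-step : ∀ g n → powerJoin g n ≤ powerJoin g (suc n)
  powerJoin-step g zero    = x≤x∨y _ _
  powerJoin-step g (suc n) = ∨-least (x≤x∨y _ _) (≤-trans (·-monoˡ g (powerJoin-step g n)) (y≤x∨y _ _))

  powerJoin-mono : ∀ g {m n} → m ℕ.≤ n → powerJoin g m ≤ powerJoin g n
  powerJoin-mono g {m} m≤n = go (ℕ.≤⇒≤′ m≤n)
    where
    go : ∀ {n} → m ℕ.≤′ n → powerJoin g m ≤ powerJoin g n
    go (ℕ.≤′-reflexive refl)  = ≤-refl
    go {suc n} (ℕ.≤′-step m≤n) = ≤-trans (go m≤n) (powerJoin-step g n)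

  -- h = e ∨ g ∨ ⋯ ∨ gⁿ satisfies h ≤ g h, and h can be cancelled.
  e≤power⇒e≤ : ∀ g n → e ≤ suc n ×ₙ g → e ≤ g
  e≤power⇒e≤ g n e≤gⁿ⁺¹ = x≤yx⇒e≤y (below n ℕ.≤-refl)
    where
    e≤gh : e ≤ g · powerJoin g n
    e≤gh = ≤-trans e≤gⁿ⁺¹ (·-monoˡ g (power≤powerJoin g n))

    below : ∀ m → m ℕ.≤ n → powerJoin g m ≤ g · powerJoin g n
    below zero    _   = e≤gh
    below (suc m) m<n = ∨-least e≤gh (·-monoˡ g (powerJoin-mono g (ℕ.<⇒≤ m<n)))

  module _ (hom : Homomorphism termAlgebra A) where
    open Homomorphism hom
    open MonoidMorphisms.IsMonoidHomomorphism isMonoidHomomorphism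

    varProduct≤power : ∀ g n → (∀ k → k ℕ.< n → ⟦ var k ⟧ ≤ g) → ⟦ varProduct n ⟧ ≤ n ×ₙ g
    varProduct≤power g zero    x≤g = ≤-reflexive ε-homo
    varProduct≤power g (suc n) x≤g = begin
      ⟦ varProduct (suc n) ⟧      ≈⟨ homo _ _ ⟩
      ⟦ var n ⟧ · ⟦ varProduct n ⟧  ≤⟨ ·-mono (x≤g n ℕ.≤-refl)
                                       (varProduct≤power g n λ k k<n → x≤g k (ℕ.m≤n⇒m≤1+n k<n)) ⟩
      g · (n ×ₙ g)                ∎

    e≤varMultiples : ∀ n b → e ≤ ⟦ varMultiples n b ⟧
    e≤varMultiples zero    b = ≤-reflexive (≈-sym ε-homo)
    e≤varMultiples (suc n) b = begin
      e                       ≤⟨ e≤varMultiples n b ⟩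
      ⟦ varMultiples n b ⟧    ≤⟨ x≤x∨y _ _ ⟩
      _                       ≈⟨ ∨-homo _ _ ⟨
      ⟦ varMultiples (suc n) b ⟧  ∎

    multiple≤varMultiples : ∀ n b k → k ℕ.< n → ⟦ var k ⟧ · ⟦ b ⟧ ≤ ⟦ varMultiples n b ⟧
    multiple≤varMultiples (suc n) b k k<1+n =
      ≤-trans (bound (ℕ.m≤n⇒m<n∨m≡n (ℕ.≤-pred k<1+n))) (≤-reflexive (≈-sym (∨-homo _ _)))
      where
      bound : k ℕ.< n ⊎ k ≡ n → ⟦ var k ⟧ · ⟦ b ⟧ ≤ ⟦ varMultiples n b ⟧ ∨ ⟦ var n ·ₜ b ⟧
      bound (inj₁ k<n)  = ≤-trans (multiple≤varMultiples n b k k<n) (x≤x∨y _ _)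
      bound (inj₂ refl) = ≤-trans (≤-reflexive (≈-sym (homo _ _))) (y≤x∨y _ _)

    varProduct≤varMultiples : ∀ n → ⟦ varProduct n ⟧ ≤ ⟦ varMultiples n (varProduct n) ⟧
    varProduct≤varMultiples n = begin
      b             ≈⟨ identityˡ b ⟨
      e · b         ≤⟨ ·-monoʳ b (e≤power⇒e≤ g n e≤gⁿ⁺¹) ⟩
      u · b ⁻¹ · b  ≈⟨ //-rightDividesˡ b u ⟩
      u             ∎
      where
      b = ⟦ varProduct n ⟧
      u = ⟦ varMultiples n (varProduct n) ⟧
      g = u · b ⁻¹

      b⁻¹≤g : b ⁻¹ ≤ g
      b⁻¹≤g = yx≤z⇒y≤zx⁻¹ (≤-trans (≤-reflexive (inverseˡ b)) (e≤varMultiples n _))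

      -- Each of the n + 1 factors of b⁻¹ · xₙ₋₁ ⋯ x₀ = e is below `g`.
      e≤gⁿ⁺¹ : e ≤ suc n ×ₙ g
      e≤gⁿ⁺¹ = begin
        e             ≈⟨ inverseˡ b ⟨
        b ⁻¹ · b      ≤⟨ ·-mono b⁻¹≤g (varProduct≤power g n λ k k<n →
                           yx≤z⇒y≤zx⁻¹ (multiple≤varMultiples n _ k k<n)) ⟩
        g · (n ×ₙ g)  ∎

  module _ (a : Carrier) where
    pow : ℤ → Carrier
    pow (+ n)    = n ×ₙ a
    pow -[1+ n ] = suc n ×ₙ (a ⁻¹)

    pow-suc : ∀ i → pow (ℤ.suc i) ≈ a · pow i
    pow-suc (+ n)          = ≈-refl
    pow-suc -[1+ zero ]    = ≈-sym (\\-leftDividesˡ a e)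
    pow-suc -[1+ suc n ]   = ≈-sym (\\-leftDividesˡ a _)

    pow-pred : ∀ i → pow (ℤ.pred i) ≈ a ⁻¹ · pow i
    pow-pred (+ zero)      = ≈-refl
    pow-pred (+ suc n)     = ≈-sym (\\-leftDividesʳ a _)
    pow-pred -[1+ n ]      = ≈-refl

    pow-+ : ∀ i j → pow (i ℤ.+ j) ≈ pow i · pow j
    pow-+ (+ zero) j = begin-equality
      pow (+ 0 ℤ.+ j)  ≡⟨ cong pow (ℤ.+-identityˡ j) ⟩
      pow j            ≈⟨ identityˡ _ ⟨
      e · pow j        ∎
    pow-+ (+ suc n) j = begin-equality
      pow (+ suc n ℤ.+ j)        ≡⟨ cong pow (ℤ.+-assoc (+ 1) (+ n) j) ⟩
      pow (ℤ.suc (+ n ℤ.+ j))    ≈⟨ pow-suc (+ n ℤ.+ j) ⟩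
      a · pow (+ n ℤ.+ j)        ≈⟨ ·-congˡ (pow-+ (+ n) j) ⟩
      a · (pow (+ n) · pow j)    ≈⟨ assoc _ _ _ ⟨
      pow (+ suc n) · pow j      ∎
    pow-+ -[1+ zero ] j = begin-equality
      pow (ℤ.pred j)           ≈⟨ pow-pred j ⟩
      a ⁻¹ · pow j             ≈⟨ ·-congʳ (identityʳ _) ⟨
      pow -[1+ 0 ] · pow j     ∎
    pow-+ -[1+ suc n ] j = begin-equality
      pow (-[1+ suc n ] ℤ.+ j)           ≡⟨ cong pow (ℤ.+-assoc -[1+ 0 ] -[1+ n ] j) ⟩
      pow (ℤ.pred (-[1+ n ] ℤ.+ j))      ≈⟨ pow-pred (-[1+ n ] ℤ.+ j) ⟩
      a ⁻¹ · pow (-[1+ n ] ℤ.+ j)        ≈⟨ ·-congˡ (pow-+ -[1+ n ] j) ⟩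
      a ⁻¹ · (pow -[1+ n ] · pow j)      ≈⟨ assoc _ _ _ ⟨
      pow -[1+ suc n ] · pow j           ∎

    module _ (e≤a : e ≤ a) where
      e≤power : ∀ n → e ≤ n ×ₙ a
      e≤power zero    = ≤-refl
      e≤power (suc n) = begin
        e             ≈⟨ identityʳ e ⟨
        e · e         ≤⟨ ·-mono e≤a (e≤power n) ⟩
        a · (n ×ₙ a)  ∎

      -- Factor aʲ = aʲ⁻ⁱ · aⁱ; the exponent j - i is a natural number, so the first factor is above
      -- `e`.
      pow-mono : ∀ {i j} → i ℤ.≤ j → pow i ≤ pow j
      pow-mono {i} {j} i≤j = begin
        pow i                        ≈⟨ identityˡ _ ⟨
        e · pow i                    ≤⟨ ·-monoʳ (pow i) (e≤power ℤ.∣ j ℤ.- i ∣) ⟩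
        pow (+ ℤ.∣ j ℤ.- i ∣) · pow i  ≈⟨ pow-+ (+ ℤ.∣ j ℤ.- i ∣) i ⟨
        pow (+ ℤ.∣ j ℤ.- i ∣ ℤ.+ i)    ≡⟨ cong (λ d → pow (d ℤ.+ i)) (ℤ.0≤i⇒+∣i∣≡i (ℤ.i≤j⇒0≤j-i i≤j)) ⟩
        pow (j ℤ.- i ℤ.+ i)          ≡⟨ cong pow (cancel i j) ⟩
        pow j                        ∎
        where
        cancel : ∀ i j → j ℤ.- i ℤ.+ i ≡ j
        cancel = solve-∀

      pow-⊔ : ∀ i j → pow (i ℤ.⊔ j) ≈ pow i ∨ pow j
      pow-⊔ i j with ℤ.≤-total i j
      ... | inj₁ i≤j = antisym
        (≤-trans (≤-reflexive (≈-reflexive (cong pow (ℤ.i≤j⇒i⊔j≡j i≤j)))) (y≤x∨y _ _))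
        (∨-least (pow-mono (ℤ.i≤i⊔j i j)) (pow-mono (ℤ.i≤j⊔i i j)))
      ... | inj₂ j≤i = antisym
        (≤-trans (≤-reflexive (≈-reflexive (cong pow (ℤ.i≥j⇒i⊔j≡i j≤i)))) (x≤x∨y _ _))
        (∨-least (pow-mono (ℤ.i≤i⊔j i j)) (pow-mono (ℤ.i≤j⊔i i j)))

      eval-pow : ∀ φ t → eval A (pow ∘ φ) t ≈ pow (evalℤ φ t)
      eval-pow φ (var i)  = ≈-refl
      eval-pow φ (s ∨ₜ t) = ≈-trans (∨-cong (eval-pow φ s) (eval-pow φ t)) (≈-sym (pow-⊔ (evalℤ φ s) (evalℤ φ t)))
      eval-pow φ (s ·ₜ t) = ≈-trans (·-cong (eval-pow φ s) (eval-pow φ t)) (≈-sym (pow-+ (evalℤ φ s) (evalℤ φ t)))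
      eval-pow φ eₜ       = ≈-refl

      -- From a · aⁱ = aⁱ⁺¹ ≤ aʲ = aⁱ cancel aⁱ. Hence `pow` is injective unless `a` is trivial.
      pow-collapse : ∀ {i j} → i ℤ.< j → pow i ≈ pow j → a ≤ e
      pow-collapse {i} {j} i<j aⁱ≈aʲ = begin
        a                  ≈⟨ identityʳ a ⟨
        a · e              ≈⟨ ·-congˡ (inverseʳ (pow i)) ⟨
        a · (pow i · pow i ⁻¹)  ≈⟨ assoc _ _ _ ⟨
        a · pow i · pow i ⁻¹    ≈⟨ ·-congʳ (pow-suc i) ⟨
        pow (ℤ.suc i) · pow i ⁻¹  ≤⟨ ·-monoʳ _ (pow-mono (ℤ.i<j⇒suc[i]≤j i<j)) ⟩
        pow j · pow i ⁻¹   ≈⟨ ·-congʳ aⁱ≈aʲ ⟨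
        pow i · pow i ⁻¹   ≈⟨ inverseʳ _ ⟩
        e                  ∎

      pow-collapse-≢ : ∀ {i j} → i ≢ j → pow i ≈ pow j → a ≤ e
      pow-collapse-≢ {i} {j} i≢j aⁱ≈aʲ with ℤ.<-cmp i j
      ... | tri< i<j _ _ = pow-collapse i<j aⁱ≈aʲ
      ... | tri≈ _ i≡j _ = contradiction i≡j i≢j
      ... | tri> _ _ j<i = pow-collapse j<i (≈-sym aⁱ≈aʲ)

  -- Equality in ℤ is decidable, so a failure in ℤ may be assumed. It collapses the powers of every
  -- `a = e ∨ x · y ⁻¹`, which forces x ≤ y for all x and y. No element strictly above `e` has to be
  -- exhibited.
  ⊨⇒evalℤ-≡ : ∀ {x y} → ¬ x ≈ y → ∀ {s t} → A ⊨ (s , t) → ∀ φ → evalℤ φ s ≡ evalℤ φ t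
  ⊨⇒evalℤ-≡ {x} {y} x≉y {s} {t} s≈t φ = decidable-stable (evalℤ φ s ℤ.≟ evalℤ φ t)
    λ s≢t → x≉y (antisym (below s≢t x y) (below s≢t y x))
    where
    below : evalℤ φ s ≢ evalℤ φ t → ∀ x y → x ≤ y
    below s≢t x y = begin
      x               ≈⟨ //-rightDividesˡ y x ⟨
      x · y ⁻¹ · y    ≤⟨ ·-monoʳ y (≤-trans (y≤x∨y e _) (a≤e)) ⟩
      e · y           ≈⟨ identityˡ y ⟩
      y               ∎
      where
      a   = e ∨ x · y ⁻¹
      e≤a = x≤x∨y e (x · y ⁻¹)

      a≤e : a ≤ e
      a≤e = pow-collapse-≢ a e≤a s≢t
        (≈-trans (≈-sym (eval-pow a e≤a φ s))
        (≈-trans (s≈t (evalHomomorphism A (pow a ∘ φ))) (eval-pow a e≤a φ t)))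

-- Monomials of a term and their weights.

-- Indexes the words of the fully distributed form of the term by the side taken at each join; equal
-- words from different places stay distinct.
Monomial : Term → Set
Monomial (var i)  = ⊤
Monomial (s ∨ₜ t) = Monomial s ⊎ Monomial t
Monomial (s ·ₜ t) = Monomial s × Monomial t
Monomial eₜ       = ⊤

monomials : ∀ t → List (Monomial t)
monomials (var i)  = tt ∷ []
monomials (s ∨ₜ t) = map inj₁ (monomials s) ++ map inj₂ (monomials t)
monomials (s ·ₜ t) = cartesianProduct (monomials s) (monomials t)
monomials eₜ       = tt ∷ []

∈-monomials : ∀ t (m : Monomial t) → m ∈ monomials t
∈-monomials (var i)  m        = here refl
∈-monomials (s ∨ₜ t) (inj₁ m) = ∈-++⁺ˡ (∈-map⁺ inj₁ (∈-monomials s m))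
∈-monomials (s ∨ₜ t) (inj₂ m) = ∈-++⁺ʳ _ (∈-map⁺ inj₂ (∈-monomials t m))
∈-monomials (s ·ₜ t) (m , n)  = ∈-cartesianProduct⁺ (∈-monomials s m) (∈-monomials t n)
∈-monomials eₜ       m        = here refl

someMonomial : ∀ t → Monomial t
someMonomial (var i)  = tt
someMonomial (s ∨ₜ t) = inj₁ (someMonomial s)
someMonomial (s ·ₜ t) = someMonomial s , someMonomial t
someMonomial eₜ       = tt

weight : (ℕ → ℤ) → ∀ t → Monomial t → ℤ
weight φ (var i)  m        = φ i
weight φ (s ∨ₜ t) (inj₁ m) = weight φ s m
weight φ (s ∨ₜ t) (inj₂ m) = weight φ t m
weight φ (s ·ₜ t) (m , n)  = weight φ s m ℤ.+ weight φ t n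
weight φ eₜ       m        = + 0

weight≤evalℤ : ∀ φ t m → weight φ t m ℤ.≤ evalℤ φ t
weight≤evalℤ φ (var i)  m        = ℤ.≤-refl
weight≤evalℤ φ (s ∨ₜ t) (inj₁ m) = ℤ.≤-trans (weight≤evalℤ φ s m) (ℤ.i≤i⊔j _ _)
weight≤evalℤ φ (s ∨ₜ t) (inj₂ m) = ℤ.≤-trans (weight≤evalℤ φ t m) (ℤ.i≤j⊔i _ _)
weight≤evalℤ φ (s ·ₜ t) (m , n)  = ℤ.+-mono-≤ (weight≤evalℤ φ s m) (weight≤evalℤ φ t n)
weight≤evalℤ φ eₜ       m        = ℤ.≤-refl

evalℤ-attained : ∀ φ t → ∃[ m ] weight φ t m ≡ evalℤ φ t
evalℤ-attained φ (var i)  = tt , refl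
evalℤ-attained φ (s ∨ₜ t) with evalℤ-attained φ s | evalℤ-attained φ t | ℤ.⊔-sel (evalℤ φ s) (evalℤ φ t)
... | m , eq | _      | inj₁ max = inj₁ m , trans eq (sym max)
... | _      | n , eq | inj₂ max = inj₂ n , trans eq (sym max)
evalℤ-attained φ (s ·ₜ t) with evalℤ-attained φ s | evalℤ-attained φ t
... | m , eq | n , eq′ = (m , n) , cong₂ ℤ._+_ eq eq′
evalℤ-attained φ eₜ       = tt , refl

-- By Farkas' lemma: every exponent vector of t lies in the convex hull of those of s.
Dominates : Term → Term → Set
Dominates s t = ∀ φ p → ∃[ q ] weight φ t p ℤ.≤ weight φ s q

evalℤ-≡⇒Dominates : ∀ s t → (∀ φ → evalℤ φ t ≡ evalℤ φ s) → Dominates s t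
evalℤ-≡⇒Dominates s t t≡s φ p with evalℤ-attained φ s
... | q , eq = q , (begin
  weight φ t p  ≤⟨ weight≤evalℤ φ t p ⟩
  evalℤ φ t     ≡⟨ t≡s φ ⟩
  evalℤ φ s     ≡⟨ eq ⟨
  weight φ s q  ∎)
  where open ℤ.≤-Reasoning

-- Kronecker delta and degrees of monomials.

δ : ℕ → ℕ → ℕ
δ zero    zero    = 1
δ zero    (suc j) = 0
δ (suc i) zero    = 0
δ (suc i) (suc j) = δ i j

δ-refl : ∀ i → δ i i ≡ 1
δ-refl zero    = refl
δ-refl (suc i) = δ-refl i

δ-≢ : ∀ {i j} → i ≢ j → δ i j ≡ 0
δ-≢ {zero}  {zero}  i≢j = contradiction refl i≢j
δ-≢ {zero}  {suc j} i≢j = refl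
δ-≢ {suc i} {zero}  i≢j = refl
δ-≢ {suc i} {suc j} i≢j = δ-≢ (i≢j ∘ cong suc)

δ≤1 : ∀ i j → δ i j ℕ.≤ 1
δ≤1 zero    zero    = ℕ.≤-refl
δ≤1 zero    (suc j) = ℕ.z≤n
δ≤1 (suc i) zero    = ℕ.z≤n
δ≤1 (suc i) (suc j) = δ≤1 i j

1≤δ⇒≡ : ∀ i j → 1 ℕ.≤ δ i j → i ≡ j
1≤δ⇒≡ zero    zero    _   = refl
1≤δ⇒≡ (suc i) (suc j) 1≤δ = cong suc (1≤δ⇒≡ i j 1≤δ)

degree : ℕ → ∀ t → Monomial t → ℕ
degree j (var i)  m        = δ i j
degree j (s ∨ₜ t) (inj₁ m) = degree j s m
degree j (s ∨ₜ t) (inj₂ m) = degree j t m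
degree j (s ·ₜ t) (m , n)  = degree j s m ℕ.+ degree j t n
degree j eₜ       m        = 0

weight-δ : ∀ j t m → weight (λ i → + δ i j) t m ≡ + degree j t m
weight-δ j (var i)  m        = refl
weight-δ j (s ∨ₜ t) (inj₁ m) = weight-δ j s m
weight-δ j (s ∨ₜ t) (inj₂ m) = weight-δ j t m
weight-δ j (s ·ₜ t) (m , n)  = cong₂ ℤ._+_ (weight-δ j s m) (weight-δ j t n)
weight-δ j eₜ       m        = refl

-- The degree in `j` is the weight under the assignment sending variable `j` to 1 and all others to
-- 0.
Dominates⇒degree≤ : ∀ s t → Dominates s t → ∀ j p → ∃[ q ] degree j t p ℕ.≤ degree j s q
Dominates⇒degree≤ s t dom j p with dom (λ i → + δ i j) p
... | q , p≤q = q , ℤ.drop‿+≤+ (≡.subst₂ ℤ._≤_ (weight-δ j t p) (weight-δ j s q) p≤q)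

-- Substitution and the monomials of instances.

infix 8 _[_]

_[_] : Term → (ℕ → Term) → Term
var i    [ σ ] = σ i
(s ∨ₜ t) [ σ ] = s [ σ ] ∨ₜ t [ σ ]
(s ·ₜ t) [ σ ] = s [ σ ] ·ₜ t [ σ ]
eₜ       [ σ ] = eₜ

module _ {σ : ℕ → Term} where

  skeleton : ∀ t → Monomial (t [ σ ]) → Monomial t
  skeleton (var i)  m        = tt
  skeleton (s ∨ₜ t) (inj₁ m) = inj₁ (skeleton s m)
  skeleton (s ∨ₜ t) (inj₂ m) = inj₂ (skeleton t m)
  skeleton (s ·ₜ t) (m , n)  = skeleton s m , skeleton t n
  skeleton eₜ       m        = tt

  -- The same monomial is used at all occurrences of a variable. A monomial of `t [ σ ]` in general
  -- may choose differently at each occurrence.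
  Choice : Set
  Choice = ∀ j → Monomial (σ j)

  instantiate : Choice → ∀ t → Monomial t → Monomial (t [ σ ])
  instantiate τ (var i)  m        = τ i
  instantiate τ (s ∨ₜ t) (inj₁ m) = inj₁ (instantiate τ s m)
  instantiate τ (s ∨ₜ t) (inj₂ m) = inj₂ (instantiate τ t m)
  instantiate τ (s ·ₜ t) (m , n)  = instantiate τ s m , instantiate τ t n
  instantiate τ eₜ       m        = tt

-- Pigeonhole principle and sums of natural numbers.

∃∉ : ∀ {n} (xs : List (Fin n)) → length xs ℕ.< n → ∃[ i ] i ∉ xs
∃∉ {n} xs short = Fin.¬∀⟶∃¬ n (_∈ xs) (λ i → Any.any? (i Fin.≟_) xs) notAll
  where
  notAll : ¬ (∀ i → i ∈ xs)
  notAll all with Fin.pigeonhole short (Any.index ∘ all)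
  ... | i , j , i<j , same = Fin.<⇒≢ i<j (trans (Any.lookup-index (all i))
    (trans (cong (lookup xs) same) (sym (Any.lookup-index (all j)))))

sum-+ : ∀ {n} (f : Fin n → ℕ) → sum (λ i → + f i) ≡ + ℕΣ.sum f
sum-+ {zero}  f = refl
sum-+ {suc n} f = cong (ℤ._+_ (+ f zero)) (sum-+ (f ∘ suc))

sum-δ : ∀ {n} (k : Fin n) → ℕΣ.sum {n} (λ i → δ (toℕ k) (toℕ i)) ≡ 1
sum-δ {suc n} zero    = cong suc (ℕΣ.sum-replicate-zero n)
sum-δ {suc n} (suc k) = sum-δ k

sum≡0⇒≡0 : ∀ {n} (f : Fin n → ℕ) → ℕΣ.sum f ≡ 0 → ∀ i → f i ≡ 0
sum≡0⇒≡0 f ∑≡0 zero    = ℕ.m+n≡0⇒m≡0 (f zero) ∑≡0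
sum≡0⇒≡0 f ∑≡0 (suc i) = sum≡0⇒≡0 (f ∘ suc) (ℕ.m+n≡0⇒n≡0 (f zero) ∑≡0) i

-- A first entry 0 leaves the total 1 to the rest, a first entry 1 leaves 0. Thus natural
-- barycentric coordinates single out a vertex.
sum≡1⇒δ : ∀ {n} (f : Fin n → ℕ) → ℕΣ.sum f ≡ 1 → ∃[ k ] (∀ i → f i ≡ δ (toℕ {n} k) (toℕ i))
sum≡1⇒δ {suc n} f ∑≡1 with f zero in eq
... | 0 with sum≡1⇒δ (f ∘ suc) ∑≡1
...   | k , f≡δ = suc k , λ { zero → eq ; (suc i) → f≡δ i }
sum≡1⇒δ {suc n} f ∑≡1 | 1 = zero , λ { zero → eq ; (suc i) → sum≡0⇒≡0 (f ∘ suc) (ℕ.suc-injective ∑≡1) i }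

-- Lattice points of the simplex.

module _ {N : ℕ} where

  Point : Set
  Point = Fin N → ℤ

  -- Points are taken modulo (1, …, 1), so that the N vertices span a simplex
  -- of dimension N - 1 whose only further lattice point is 0, its barycentre.
  VertexAt : Fin N → Point → Set
  VertexAt k x = ∃[ m ] (∀ i → x i ≡ m ℤ.+ + δ (toℕ k) (toℕ i))

  Vertex : Point → Set
  Vertex x = ∃[ k ] VertexAt k x

  infix 4 _∼_

  _∼_ : Point → Point → Set
  x ∼ y = ∃[ d ] (∀ i → x i ≡ d ℤ.+ y i)

  ∼-refl : ∀ {x} → x ∼ x
  ∼-refl {x} = + 0 , λ i → sym (ℤ.+-identityˡ (x i))

  ∼-reflexive : ∀ {x y} → (∀ i → x i ≡ y i) → x ∼ y
  ∼-reflexive {y = y} x≡y = + 0 , λ i → trans (x≡y i) (sym (ℤ.+-identityˡ (y i)))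

  ∼-trans : ∀ {x y z} → x ∼ y → y ∼ z → x ∼ z
  ∼-trans {z = z} (d , x≡y) (d′ , y≡z) = d ℤ.+ d′ , λ i →
    trans (x≡y i) (trans (cong (ℤ._+_ d) (y≡z i)) (sym (ℤ.+-assoc d d′ (z i))))

  ∼-+ : ∀ {x y x′ y′} → x ∼ x′ → y ∼ y′ → (λ i → x i ℤ.+ y i) ∼ (λ i → x′ i ℤ.+ y′ i)
  ∼-+ {x′ = x′} {y′} (d , x≡x′) (d′ , y≡y′) = d ℤ.+ d′ , λ i →
    trans (cong₂ ℤ._+_ (x≡x′ i) (y≡y′ i)) (interchange d d′ (x′ i) (y′ i))
    where
    interchange : ∀ a b c d → (a ℤ.+ c) ℤ.+ (b ℤ.+ d) ≡ (a ℤ.+ b) ℤ.+ (c ℤ.+ d)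
    interchange = solve-∀

  Vertex-resp-∼ : ∀ {x y} → x ∼ y → Vertex y → Vertex x
  Vertex-resp-∼ (d , x≡y) (k , m , y≡) = k , d ℤ.+ m , λ i →
    trans (x≡y i) (trans (cong (ℤ._+_ d) (y≡ i)) (sym (ℤ.+-assoc d m _)))

  Vertex-resp-≗ : ∀ {x y} → (∀ i → x i ≡ y i) → Vertex y → Vertex x
  Vertex-resp-≗ x≡y = Vertex-resp-∼ (∼-reflexive x≡y)

  record Additive (L : Point → ℤ) : Set where
    field
      L-0 : L (λ _ → + 0) ≡ + 0
      L-+ : ∀ x y → L (λ i → x i ℤ.+ y i) ≡ L x ℤ.+ L y

  -- Unchanged by adding multiples of (1, ..., 1), hence a functional on points modulo `∼`.
  difference : Fin N → Fin N → Point → ℤ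
  difference i j x = x i ℤ.- x j

  difference-additive : ∀ i j → Additive (difference i j)
  difference-additive i j = record { L-0 = refl ; L-+ = λ x y → interchange (x i) (y i) (x j) (y j) }
    where
    interchange : ∀ a b c d → (a ℤ.+ b) ℤ.- (c ℤ.+ d) ≡ (a ℤ.- c) ℤ.+ (b ℤ.- d)
    interchange = solve-∀

  -- Takes the value 1 at all vertices of the facet opposite to `i₀`, which gives the equation of
  -- its hyperplane.
  height : Fin N → Point → ℤ
  height i₀ x = sum (λ i → difference i i₀ x)

  height-additive : ∀ i₀ → Additive (height i₀)
  height-additive i₀ = record
    { L-0 = sum-replicate-zero N
    ; L-+ = λ x y → trans
        (sum-cong-≗ λ i → Additive.L-+ (difference-additive i i₀) x y)
        (∑-distrib-+ (λ i → difference i i₀ x) (λ i → difference i i₀ y)) }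

  neg-additive : ∀ {L} → Additive L → Additive (ℤ.-_ ∘ L)
  neg-additive {L} L-additive = record
    { L-0 = cong ℤ.-_ L-0
    ; L-+ = λ x y → trans (cong ℤ.-_ (L-+ x y)) (ℤ.neg-distrib-+ (L x) (L y)) }
    where open Additive L-additive

  difference-vertex : ∀ {k i₀ x} → VertexAt k x → k ≢ i₀ → ∀ i → difference i i₀ x ≡ + δ (toℕ k) (toℕ i)
  difference-vertex {k} {i₀} {x} (m , x≡) k≢i₀ i = begin
    x i ℤ.- x i₀                                     ≡⟨ cong₂ ℤ._-_ (x≡ i) (x≡ i₀) ⟩
    (m ℤ.+ + δ (toℕ k) (toℕ i)) ℤ.- (m ℤ.+ + δ (toℕ k) (toℕ i₀))
      ≡⟨ cong (λ d → (m ℤ.+ + δ (toℕ k) (toℕ i)) ℤ.- (m ℤ.+ + d)) (δ-≢ (k≢i₀ ∘ Fin.toℕ-injective)) ⟩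
    (m ℤ.+ + δ (toℕ k) (toℕ i)) ℤ.- (m ℤ.+ + 0)      ≡⟨ cancel m _ ⟩
    + δ (toℕ k) (toℕ i)                              ∎
    where
    open ≡.≡-Reasoning
    cancel : ∀ a b → (a ℤ.+ b) ℤ.- (a ℤ.+ + 0) ≡ b
    cancel = solve-∀

  height-vertex : ∀ {k i₀ x} → VertexAt k x → k ≢ i₀ → height i₀ x ≡ + 1
  height-vertex {k} v k≢i₀ = trans (sum-cong-≗ (difference-vertex v k≢i₀))
    (trans (sum-+ {N} (λ i → δ (toℕ k) (toℕ i))) (cong +_ (sum-δ {N} k)))

  -- Convex hull in dual form: no functional is larger at `x` than at every representative `y` of
  -- the vertices other than `i₀`.
  InFacetHull : Fin N → Point → Set
  InFacetHull i₀ x = ∀ {L} → Additive L → ∃₂ λ k y → VertexAt k y × k ≢ i₀ × L x ℤ.≤ L y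

  -- On the facet opposite to i₀ the barycentric coordinates are the xᵢ - xᵢ₀,
  -- which are integers as x is a lattice point.
  facetHull⇒Vertex : ∀ {i₀ x} → InFacetHull i₀ x → Vertex x
  facetHull⇒Vertex {i₀} {x} hull = let k , d≡δ = sum≡1⇒δ _ ∑≡1 in k , x i₀ , λ i → begin
    x i                                ≡⟨ split (x i) (x i₀) ⟩
    x i₀ ℤ.+ difference i i₀ x         ≡⟨ cong (ℤ._+_ (x i₀)) (ℤ.0≤i⇒+∣i∣≡i (nonneg i)) ⟨
    x i₀ ℤ.+ + ℤ.∣ difference i i₀ x ∣  ≡⟨ cong (λ d → x i₀ ℤ.+ + d) (d≡δ i) ⟩
    x i₀ ℤ.+ + δ (toℕ k) (toℕ i)       ∎
    where
    open ≡.≡-Reasoning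

    split : ∀ a b → a ≡ b ℤ.+ (a ℤ.- b)
    split = solve-∀

    -- Negating a functional turns the upper bound from the hull into a lower bound.
    nonneg : ∀ i → + 0 ℤ.≤ difference i i₀ x
    nonneg i with hull (neg-additive (difference-additive i i₀))
    ... | k , y , v , k≢i₀ , x≤y = ℤ.neg-cancel-≤ (ℤ.≤-trans x≤y
      (subst (λ d → ℤ.- d ℤ.≤ + 0) (sym (difference-vertex v k≢i₀ i)) (ℤ.neg-mono-≤ (ℤ.+≤+ ℕ.z≤n))))

    height≡1 : height i₀ x ≡ + 1
    height≡1 with hull (height-additive i₀) | hull (neg-additive (height-additive i₀))
    ... | _ , _ , v , k≢i₀ , x≤y | _ , _ , v′ , k′≢i₀ , x≥y = ℤ.≤-antisym
      (subst (height i₀ x ℤ.≤_) (height-vertex v k≢i₀) x≤y)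
      (subst (ℤ._≤ height i₀ x) (height-vertex v′ k′≢i₀) (ℤ.neg-cancel-≤ x≥y))

    ∑≡1 : ℕΣ.sum (λ i → ℤ.∣ difference i i₀ x ∣) ≡ 1
    ∑≡1 = ℤ.+-injective (trans (sym (sum-+ {N} _))
      (trans (sum-cong-≗ (λ i → ℤ.0≤i⇒+∣i∣≡i (nonneg i))) height≡1))

  -- Evaluate the three vertices at the coordinates k₃ and k₁: k₃ ≢ k₁ would
  -- make some δ at least 3.
  midpoint-vertex : ∀ (w y y′ : Point) →
    Vertex (λ i → w i ℤ.+ y i ℤ.+ y i) →
    Vertex (λ i → w i ℤ.+ y i ℤ.+ y′ i) →
    Vertex (λ i → w i ℤ.+ y′ i ℤ.+ y′ i) →
    y ∼ y′
  midpoint-vertex w y y′ (k₁ , m₁ , v₁) (k₃ , m₃ , v₃) (k₂ , m₂ , v₂) with k₁ Fin.≟ k₃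
  ... | yes refl = m₁ ℤ.- m₃ , λ i → begin
    y i                                              ≡⟨ expand (w i) (y i) (y′ i) ⟩
    (w i ℤ.+ y i ℤ.+ y i) ℤ.- (w i ℤ.+ y i ℤ.+ y′ i) ℤ.+ y′ i
      ≡⟨ cong₂ (λ a b → a ℤ.- b ℤ.+ y′ i) (v₁ i) (v₃ i) ⟩
    (m₁ ℤ.+ δ₁ i) ℤ.- (m₃ ℤ.+ δ₁ i) ℤ.+ y′ i         ≡⟨ cancel m₁ m₃ (δ₁ i) (y′ i) ⟩
    m₁ ℤ.- m₃ ℤ.+ y′ i                               ∎
    where
    open ≡.≡-Reasoning
    δ₁ : Fin N → ℤ
    δ₁ i = + δ (toℕ k₁) (toℕ i)

    expand : ∀ w y y′ → y ≡ (w ℤ.+ y ℤ.+ y) ℤ.- (w ℤ.+ y ℤ.+ y′) ℤ.+ y′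
    expand = solve-∀

    cancel : ∀ a b d y → (a ℤ.+ d) ℤ.- (b ℤ.+ d) ℤ.+ y ≡ a ℤ.- b ℤ.+ y
    cancel = solve-∀
  ... | no k₁≢k₃ = contradiction (ℕ.≤-trans (subst (3 ℕ.≤_) (sym δ≡3+) (ℕ.m≤m+n 3 _)) (δ≤1 (toℕ k₂) (toℕ k₃)))
    λ { (ℕ.s≤s ()) }
    where
    δᵢ : Fin N → Fin N → ℤ
    δᵢ k i = + δ (toℕ k) (toℕ i)

    midpoint : ∀ i → (m₁ ℤ.+ δᵢ k₁ i) ℤ.+ (m₂ ℤ.+ δᵢ k₂ i) ≡ (m₃ ℤ.+ δᵢ k₃ i) ℤ.+ (m₃ ℤ.+ δᵢ k₃ i)
    midpoint i = trans (sym (cong₂ ℤ._+_ (v₁ i) (v₂ i)))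
      (trans (rearrange (w i) (y i) (y′ i)) (cong₂ ℤ._+_ (v₃ i) (v₃ i)))
      where
      rearrange : ∀ w y y′ → (w ℤ.+ y ℤ.+ y) ℤ.+ (w ℤ.+ y′ ℤ.+ y′) ≡ (w ℤ.+ y ℤ.+ y′) ℤ.+ (w ℤ.+ y ℤ.+ y′)
      rearrange = solve-∀

    at-k₃ : (m₁ ℤ.+ + 0) ℤ.+ (m₂ ℤ.+ δᵢ k₂ k₃) ≡ (m₃ ℤ.+ + 1) ℤ.+ (m₃ ℤ.+ + 1)
    at-k₃ = ≡.subst₂ (λ a b → (m₁ ℤ.+ + a) ℤ.+ (m₂ ℤ.+ δᵢ k₂ k₃) ≡ (m₃ ℤ.+ + b) ℤ.+ (m₃ ℤ.+ + b))
      (δ-≢ (k₁≢k₃ ∘ Fin.toℕ-injective)) (δ-refl (toℕ k₃)) (midpoint k₃)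

    at-k₁ : (m₁ ℤ.+ + 1) ℤ.+ (m₂ ℤ.+ δᵢ k₂ k₁) ≡ (m₃ ℤ.+ + 0) ℤ.+ (m₃ ℤ.+ + 0)
    at-k₁ = ≡.subst₂ (λ a b → (m₁ ℤ.+ + a) ℤ.+ (m₂ ℤ.+ δᵢ k₂ k₁) ≡ (m₃ ℤ.+ + b) ℤ.+ (m₃ ℤ.+ + b))
      (δ-refl (toℕ k₁)) (δ-≢ (k₁≢k₃ ∘ sym ∘ Fin.toℕ-injective)) (midpoint k₁)

    -- The right-hand sides of `at-k₃` and `at-k₁` differ by 2, and the extra 1 on the left of
    -- `at-k₁` makes this 3.
    δ≡3+ : δ (toℕ k₂) (toℕ k₃) ≡ 3 ℕ.+ δ (toℕ k₂) (toℕ k₁)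
    δ≡3+ = ℤ.+-injective (begin
      δᵢ k₂ k₃                                           ≡⟨ isolate₃ m₁ m₂ (δᵢ k₂ k₃) ⟩
      ((m₁ ℤ.+ + 0) ℤ.+ (m₂ ℤ.+ δᵢ k₂ k₃)) ℤ.- m₁ ℤ.- m₂  ≡⟨ cong (λ a → a ℤ.- m₁ ℤ.- m₂) at-k₃ ⟩
      ((m₃ ℤ.+ + 1) ℤ.+ (m₃ ℤ.+ + 1)) ℤ.- m₁ ℤ.- m₂      ≡⟨ shift m₁ m₂ m₃ ⟩
      ((m₃ ℤ.+ + 0) ℤ.+ (m₃ ℤ.+ + 0)) ℤ.- m₁ ℤ.- m₂ ℤ.+ + 2
        ≡⟨ cong (λ a → a ℤ.- m₁ ℤ.- m₂ ℤ.+ + 2) at-k₁ ⟨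
      ((m₁ ℤ.+ + 1) ℤ.+ (m₂ ℤ.+ δᵢ k₂ k₁)) ℤ.- m₁ ℤ.- m₂ ℤ.+ + 2  ≡⟨ isolate₁ m₁ m₂ (δᵢ k₂ k₁) ⟩
      + 3 ℤ.+ δᵢ k₂ k₁                                   ∎)
      where
      open ≡.≡-Reasoning
      isolate₃ : ∀ a b d → d ≡ ((a ℤ.+ + 0) ℤ.+ (b ℤ.+ d)) ℤ.- a ℤ.- b
      isolate₃ = solve-∀

      isolate₁ : ∀ a b d → ((a ℤ.+ + 1) ℤ.+ (b ℤ.+ d)) ℤ.- a ℤ.- b ℤ.+ + 2 ≡ + 3 ℤ.+ d
      isolate₁ = solve-∀

      shift : ∀ a b c →
        ((c ℤ.+ + 1) ℤ.+ (c ℤ.+ + 1)) ℤ.- a ℤ.- b ≡ ((c ℤ.+ + 0) ℤ.+ (c ℤ.+ + 0)) ℤ.- a ℤ.- b ℤ.+ + 2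
      shift = solve-∀

  -- Exponents of substitution instances.

  exponent : ∀ t → Monomial t → Point
  exponent t m i = + degree (toℕ i) t m

  module _ {σ : ℕ → Term} where

    instantiate-cong : ∀ {τ τ′ : Choice {σ}} t p →
      (∀ j → 1 ℕ.≤ degree j t p → exponent (σ j) (τ j) ∼ exponent (σ j) (τ′ j)) →
      exponent (t [ σ ]) (instantiate τ t p) ∼ exponent (t [ σ ]) (instantiate τ′ t p)
    instantiate-cong (var i)  p        τ∼τ′ = τ∼τ′ i (ℕ.≤-reflexive (sym (δ-refl i)))
    instantiate-cong (s ∨ₜ t) (inj₁ p) τ∼τ′ = instantiate-cong s p τ∼τ′
    instantiate-cong (s ∨ₜ t) (inj₂ p) τ∼τ′ = instantiate-cong t p τ∼τ′
    instantiate-cong (s ·ₜ t) (p , q)  τ∼τ′ = ∼-+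
      (instantiate-cong s p λ j 1≤ → τ∼τ′ j (ℕ.≤-trans 1≤ (ℕ.m≤m+n _ _)))
      (instantiate-cong t q λ j 1≤ → τ∼τ′ j (ℕ.≤-trans 1≤ (ℕ.m≤n+m _ _)))
    instantiate-cong eₜ       p        τ∼τ′ = ∼-refl

    -- Distinct occurrences of a variable in a monomial may select distinct
    -- monomials of its image; this is harmless if those agree modulo (1, …, 1).
    consistentChoice : ∀ t (m : Monomial (t [ σ ])) →
      (∀ j → 2 ℕ.≤ degree j t (skeleton t m) → ∀ y y′ → exponent (σ j) y ∼ exponent (σ j) y′) →
      ∃[ τ ] exponent (t [ σ ]) m ∼ exponent (t [ σ ]) (instantiate τ t (skeleton t m))
    consistentChoice (var i) m rigid = τ , subst (λ y → exponent (σ i) m ∼ exponent (σ i) y) (sym τi≡m) ∼-refl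
      where
      τ : Choice {σ}
      τ j with j ℕ.≟ i
      ... | yes refl = m
      -- A default value: `var i` contains no other variable.
      ... | no  _    = someMonomial (σ j)

      τi≡m : τ i ≡ m
      τi≡m with i ℕ.≟ i
      ... | yes refl = refl
      ... | no  i≢i  = contradiction refl i≢i
    consistentChoice (s ∨ₜ t) (inj₁ m) rigid = consistentChoice s m rigid
    consistentChoice (s ∨ₜ t) (inj₂ m) rigid = consistentChoice t m rigid
    consistentChoice (s ·ₜ t) (m , n)  rigid = τ , ∼-+
      (∼-trans (proj₂ left) (instantiate-cong s p agree₁))
      (∼-trans (proj₂ right) (instantiate-cong t q agree₂))
      where
      p = skeleton s m
      q = skeleton t n
      left  = consistentChoice s m λ j 2≤ → rigid j (ℕ.≤-trans 2≤ (ℕ.m≤m+n _ _))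
      right = consistentChoice t n λ j 2≤ → rigid j (ℕ.≤-trans 2≤ (ℕ.m≤n+m _ _))
      τ₁ = proj₁ left
      τ₂ = proj₁ right

      τ : Choice {σ}
      τ j with 1 ℕ.≤? degree j s p
      ... | yes _ = τ₁ j
      ... | no  _ = τ₂ j

      agree₁ : ∀ j → 1 ℕ.≤ degree j s p → exponent (σ j) (τ₁ j) ∼ exponent (σ j) (τ j)
      agree₁ j 1≤p with 1 ℕ.≤? degree j s p
      ... | yes _   = ∼-refl
      ... | no  1≰p = contradiction 1≤p 1≰p

      agree₂ : ∀ j → 1 ℕ.≤ degree j t q → exponent (σ j) (τ₂ j) ∼ exponent (σ j) (τ j)
      agree₂ j 1≤q with 1 ℕ.≤? degree j s p
      -- Variable `j` occurs in both factors, hence at least twice in the product, so rigidity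
      -- reconciles the two choices.
      ... | yes 1≤p = rigid j (ℕ.+-mono-≤ 1≤p 1≤q) (τ₂ j) (τ₁ j)
      ... | no  _   = ∼-refl
    consistentChoice eₜ m rigid = (λ j → someMonomial (σ j)) , ∼-refl

    vary₁ : ∀ j t q → 1 ℕ.≤ degree j t q →
      ∃ λ (w : Point) → ∀ y → ∃[ m ] (∀ i → exponent (t [ σ ]) m i ≡ w i ℤ.+ exponent (σ j) y i)
    vary₁ j (var k) q 1≤ with refl ← 1≤δ⇒≡ k j 1≤ = (λ _ → + 0) , λ y → y , λ i → refl
    vary₁ j (s ∨ₜ t) (inj₁ q) 1≤ =
      let w , v = vary₁ j s q 1≤ in w , λ y → let m , eq = v y in inj₁ m , eq
    vary₁ j (s ∨ₜ t) (inj₂ q) 1≤ =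
      let w , v = vary₁ j t q 1≤ in w , λ y → let m , eq = v y in inj₂ m , eq
    vary₁ j (s ·ₜ t) (p , q) 1≤ with 1 ℕ.≤? degree j s p
    ... | yes 1≤p =
      let w , v = vary₁ j s p 1≤p
          n     = someMonomial (t [ σ ])
      in (λ i → w i ℤ.+ exponent (t [ σ ]) n i) , λ y →
         let m , eq = v y
         in (m , n) , λ i → trans (cong (ℤ._+ exponent (t [ σ ]) n i) (eq i)) (swap (w i) _ _)
      where
      swap : ∀ a b c → a ℤ.+ b ℤ.+ c ≡ a ℤ.+ c ℤ.+ b
      swap = solve-∀
    ... | no 1≰p =
      let w , v = vary₁ j t q (subst (λ d → 1 ℕ.≤ d ℕ.+ degree j t q) (ℕ.n<1⇒n≡0 (ℕ.≰⇒> 1≰p)) 1≤)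
          m     = someMonomial (s [ σ ])
      in (λ i → exponent (s [ σ ]) m i ℤ.+ w i) , λ y →
         let n , eq = v y
         in (m , n) , λ i → trans (cong (ℤ._+_ (exponent (s [ σ ]) m i)) (eq i))
           (sym (ℤ.+-assoc (exponent (s [ σ ]) m i) (w i) (exponent (σ j) y i)))

    -- Two occurrences of `var j` lie in different factors of some product and can be filled
    -- independently. This supplies the three points of `midpoint-vertex`.
    vary₂ : ∀ j t q → 2 ℕ.≤ degree j t q →
      ∃ λ (w : Point) → ∀ y y′ →
        ∃[ m ] (∀ i → exponent (t [ σ ]) m i ≡ w i ℤ.+ exponent (σ j) y i ℤ.+ exponent (σ j) y′ i)
    vary₂ j (var k) q 2≤ = contradiction (ℕ.≤-trans 2≤ (δ≤1 k j)) λ { (ℕ.s≤s ()) }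
    vary₂ j (s ∨ₜ t) (inj₁ q) 2≤ =
      let w , v = vary₂ j s q 2≤ in w , λ y y′ → let m , eq = v y y′ in inj₁ m , eq
    vary₂ j (s ∨ₜ t) (inj₂ q) 2≤ =
      let w , v = vary₂ j t q 2≤ in w , λ y y′ → let m , eq = v y y′ in inj₂ m , eq
    vary₂ j (s ·ₜ t) (p , q) 2≤ with 1 ℕ.≤? degree j s p | 1 ℕ.≤? degree j t q
    ... | yes 1≤p | yes 1≤q =
      let w , v   = vary₁ j s p 1≤p
          w′ , v′ = vary₁ j t q 1≤q
      in (λ i → w i ℤ.+ w′ i) , λ y y′ →
         let m , eq  = v y
             n , eq′ = v′ y′
         in (m , n) , λ i → trans (cong₂ ℤ._+_ (eq i) (eq′ i)) (interchange (w i) _ (w′ i) _)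
      where
      interchange : ∀ a b c d → (a ℤ.+ b) ℤ.+ (c ℤ.+ d) ≡ a ℤ.+ c ℤ.+ b ℤ.+ d
      interchange = solve-∀
    ... | no 1≰p | _ =
      let w , v = vary₂ j t q (subst (λ d → 2 ℕ.≤ d ℕ.+ degree j t q) (ℕ.n<1⇒n≡0 (ℕ.≰⇒> 1≰p)) 2≤)
          m     = someMonomial (s [ σ ])
      in (λ i → exponent (s [ σ ]) m i ℤ.+ w i) , λ y y′ →
         let n , eq = v y y′
         in (m , n) , λ i → trans (cong (ℤ._+_ (exponent (s [ σ ]) m i)) (eq i))
           (reassociate (exponent (s [ σ ]) m i) (w i) (exponent (σ j) y i) (exponent (σ j) y′ i))
      where
      reassociate : ∀ a b c d → a ℤ.+ (b ℤ.+ c ℤ.+ d) ≡ a ℤ.+ b ℤ.+ c ℤ.+ d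
      reassociate = solve-∀
    ... | yes _ | no 1≰q =
      let q≡0   = ℕ.n<1⇒n≡0 (ℕ.≰⇒> 1≰q)
          w , v = vary₂ j s p (subst (2 ℕ.≤_) (trans (cong (degree j s p ℕ.+_) q≡0) (ℕ.+-identityʳ _)) 2≤)
          n     = someMonomial (t [ σ ])
      in (λ i → w i ℤ.+ exponent (t [ σ ]) n i) , λ y y′ →
         let m , eq = v y y′
         in (m , n) , λ i → trans (cong (ℤ._+ exponent (t [ σ ]) n i) (eq i)) (rotate (w i) _ _ _)
      where
      rotate : ∀ a b c d → a ℤ.+ b ℤ.+ c ℤ.+ d ≡ a ℤ.+ d ℤ.+ b ℤ.+ c
      rotate = solve-∀

    -- Because `τ` treats all occurrences of a variable alike, the values of `L` form a single
    -- integer assignment, to which `Dominates` applies.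
    additive-instantiate : ∀ {L} → Additive L → ∀ (τ : Choice {σ}) t p →
      L (exponent (t [ σ ]) (instantiate τ t p)) ≡ weight (λ j → L (exponent (σ j) (τ j))) t p
    additive-instantiate         add τ (var i)  p        = refl
    additive-instantiate         add τ (s ∨ₜ t) (inj₁ p) = additive-instantiate add τ s p
    additive-instantiate         add τ (s ∨ₜ t) (inj₂ p) = additive-instantiate add τ t p
    additive-instantiate         add τ (s ·ₜ t) (p , q)  =
      trans (Additive.L-+ add (exponent (s [ σ ]) _) (exponent (t [ σ ]) _))
            (cong₂ ℤ._+_ (additive-instantiate add τ s p) (additive-instantiate add τ t q))
    additive-instantiate         add τ eₜ       p        = Additive.L-0 add

  -- The model and the equations that hold in it.

  infixl 6 _⊕_

  _⊕_ : Point → Point → Point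
  (x ⊕ y) i = x i ℤ.+ y i

  -- The translate of the set of exponents of t by c consists of vertices.
  Fits : Point → Term → Set
  Fits c t = ∀ m → Vertex (c ⊕ exponent t m)

  infix 4 _⊑_

  -- Reverses the order given by joins: `s ∨ₜ t ⊑ s`, since fewer exponents fit more easily.
  _⊑_ : Term → Term → Set
  s ⊑ t = ∀ c → Fits c s → Fits c t

  -- Up to `∼`, a monomial of `t [ σ ]` comes from a uniform choice `τ`. Its translate lies in the
  -- convex hull of the vertices given by `τ` on the monomials of `s`. These are fewer than `N`, so
  -- they miss some `i₀` and lie in one facet.
  ⊑-substitution : ∀ s t → Dominates s t → length (monomials s) ℕ.< N → ∀ σ → s [ σ ] ⊑ t [ σ ]
  ⊑-substitution s t dominates few σ c fits m = Vertex-resp-∼ (∼-+ (∼-refl {c}) m∼)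
    (facetHull⇒Vertex {proj₁ missing} hull)
    where
    p = skeleton t m

    -- By domination `j` also occurs twice in some monomial of `s`, whose instances are known to
    -- fit.
    rigid : ∀ j → 2 ℕ.≤ degree j t p → ∀ y y′ → exponent (σ j) y ∼ exponent (σ j) y′
    rigid j 2≤p y y′ =
      let q , p≤q = Dominates⇒degree≤ s t dominates j p
          w , v   = vary₂ j s q (ℕ.≤-trans 2≤p p≤q)
          shifted : ∀ y y′ → Vertex (λ i → (c ⊕ w) i ℤ.+ exponent (σ j) y i ℤ.+ exponent (σ j) y′ i)
          shifted y y′ = let n , eq = v y y′ in Vertex-resp-≗
            (λ i → sym (trans (cong (ℤ._+_ (c i)) (eq i)) (reassociate (c i) (w i) _ _))) (fits n)
      in midpoint-vertex (c ⊕ w) (exponent (σ j) y) (exponent (σ j) y′)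
           (shifted y y) (shifted y y′) (shifted y′ y′)
      where
      reassociate : ∀ a b c d → a ℤ.+ (b ℤ.+ c ℤ.+ d) ≡ a ℤ.+ b ℤ.+ c ℤ.+ d
      reassociate = solve-∀

    consistent = consistentChoice t m rigid
    τ  = proj₁ consistent
    m∼ = proj₂ consistent

    instance-vertex : ∀ q → Vertex (c ⊕ exponent (s [ σ ]) (instantiate τ s q))
    instance-vertex q = fits (instantiate τ s q)

    vertices : List (Fin N)
    vertices = map (proj₁ ∘ instance-vertex) (monomials s)

    missing : ∃[ i₀ ] i₀ ∉ vertices
    missing = ∃∉ vertices (subst (ℕ._< N) (sym (List.length-map _ (monomials s))) few)

    hull : InFacetHull (proj₁ missing) (c ⊕ exponent (t [ σ ]) (instantiate τ t p))
    hull {L} add =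
      let φ       = λ j → L (exponent (σ j) (τ j))
          q , p≤q = dominates φ p
      in proj₁ (instance-vertex q) , _ , proj₂ (instance-vertex q) ,
         (λ k≡i₀ → proj₂ missing (subst (_∈ vertices) k≡i₀ (∈-map⁺ _ (∈-monomials s q)))) ,
         (begin
           L (c ⊕ exponent (t [ σ ]) (instantiate τ t p))  ≡⟨ expand t p ⟩
           L c ℤ.+ weight φ t p                            ≤⟨ ℤ.+-monoʳ-≤ (L c) p≤q ⟩
           L c ℤ.+ weight φ s q                            ≡⟨ expand s q ⟨
           L (c ⊕ exponent (s [ σ ]) (instantiate τ s q))  ∎)
      where
      open ℤ.≤-Reasoning
      expand : ∀ t p →
        L (c ⊕ exponent (t [ σ ]) (instantiate τ t p)) ≡ L c ℤ.+ weight (λ j → L (exponent (σ j) (τ j))) t p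
      expand t p = trans (Additive.L-+ add c _) (cong (ℤ._+_ (L c)) (additive-instantiate add τ t p))

  ⊑-∨ : ∀ {s s′ t t′} → s ⊑ s′ → t ⊑ t′ → s ∨ₜ t ⊑ s′ ∨ₜ t′
  ⊑-∨ s⊑s′ t⊑t′ c fits (inj₁ m) = s⊑s′ c (fits ∘ inj₁) m
  ⊑-∨ s⊑s′ t⊑t′ c fits (inj₂ m) = t⊑t′ c (fits ∘ inj₂) m

  -- Replace one factor at a time, absorbing the exponent of the other into the translation `c`.
  ⊑-· : ∀ {s s′ t t′} → s ⊑ s′ → t ⊑ t′ → s ·ₜ t ⊑ s′ ·ₜ t′
  ⊑-· {s} {s′} {t} {t′} s⊑s′ t⊑t′ c fits (m , n) =
    Vertex-resp-≗ (λ i → sym (ℤ.+-assoc (c i) _ _))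
      (t⊑t′ (c ⊕ exponent s′ m) (λ n →
        Vertex-resp-≗ (λ i → swap (c i) _ _)
          (s⊑s′ (c ⊕ exponent t n) (λ m → Vertex-resp-≗ (λ i → rotate (c i) _ _) (fits (m , n))) m))
        n)
    where
    swap : ∀ a b c → a ℤ.+ b ℤ.+ c ≡ a ℤ.+ c ℤ.+ b
    swap = solve-∀
    rotate : ∀ a b c → a ℤ.+ b ℤ.+ c ≡ a ℤ.+ (c ℤ.+ b)
    rotate = solve-∀

  infix 4 _≃_

  _≃_ : Term → Term → Set
  s ≃ t = s ⊑ t × t ⊑ s

  -- Quotient of the term algebra by the syntactic congruence of the set of terms
  -- all of whose exponents are vertices.
  model : ∀ c ℓ → L-Algebra c ℓ
  model c ℓ = record
    -- `Lift` brings the model to the universe levels over which completeness of a basis quantifies.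
    { Carrier       = Lift c Term
    ; _≈_           = λ s t → Lift ℓ (lower s ≃ lower t)
    ; _∨_           = λ s t → lift (lower s ∨ₜ lower t)
    ; _·_           = λ s t → lift (lower s ·ₜ lower t)
    ; e             = lift eₜ
    ; ≈-equivalence = record
      { refl  = lift ((λ _ fits → fits) , λ _ fits → fits)
      ; sym   = λ (lift (s⊑t , t⊑s)) → lift (t⊑s , s⊑t)
      ; trans = λ (lift (r⊑s , s⊑r)) (lift (s⊑t , t⊑s)) →
          lift ((λ c → s⊑t c ∘ r⊑s c) , λ c → s⊑r c ∘ t⊑s c)
      }
    ; ∨-cong        = λ { {lift s} {lift s′} {lift t} {lift t′} (lift (s⊑s′ , s′⊑s)) (lift (t⊑t′ , t′⊑t)) →
        lift (⊑-∨ {s} {s′} {t} {t′} s⊑s′ t⊑t′ , ⊑-∨ {s′} {s} {t′} {t} s′⊑s t′⊑t) }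
    ; ·-cong        = λ { {lift s} {lift s′} {lift t} {lift t′} (lift (s⊑s′ , s′⊑s)) (lift (t⊑t′ , t′⊑t)) →
        lift (⊑-· {s} {s′} {t} {t′} s⊑s′ t⊑t′ , ⊑-· {s′} {s} {t′} {t} s′⊑s t′⊑t) }
    }

  module _ {c ℓ} (hom : Homomorphism termAlgebra (model c ℓ)) where
    open Homomorphism hom
    open MonoidMorphisms.IsMonoidHomomorphism isMonoidHomomorphism using (homo; ε-homo)
    open L-Algebra (model c ℓ) using (_≈_; ≈-equivalence; ∨-cong; ·-cong)
    private module ≈ = IsEquivalence ≈-equivalence

    images : ℕ → Term
    images j = lower ⟦ var j ⟧

    -- Reduces satisfaction in the quotient to substitution instances.
    ⟦⟧≈substitution : ∀ t → ⟦ t ⟧ ≈ lift (t [ images ])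
    ⟦⟧≈substitution (var j)  = ≈.refl
    ⟦⟧≈substitution (s ∨ₜ t) = ≈.trans (∨-homo s t) (∨-cong (⟦⟧≈substitution s) (⟦⟧≈substitution t))
    ⟦⟧≈substitution (s ·ₜ t) = ≈.trans (homo s t) (·-cong (⟦⟧≈substitution s) (⟦⟧≈substitution t))
    ⟦⟧≈substitution eₜ       = ε-homo

  model-⊨ : ∀ {c ℓ} s t → (∀ φ → evalℤ φ s ≡ evalℤ φ t) →
    length (monomials s) ℕ.< N → length (monomials t) ℕ.< N → model c ℓ ⊨ (s , t)
  model-⊨ {c} {ℓ} s t s≡t few-s few-t hom = ≈.trans (⟦⟧≈substitution hom s) (≈.trans
    (lift (⊑-substitution s t (evalℤ-≡⇒Dominates s t (sym ∘ s≡t)) few-s (images hom)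
         , ⊑-substitution t s (evalℤ-≡⇒Dominates t s s≡t) few-t (images hom)))
    (≈.sym (⟦⟧≈substitution hom t)))
    where module ≈ = IsEquivalence (L-Algebra.≈-equivalence (model c ℓ))

-- Failure of the inequality in the model.

degree-varProduct-≥ : ∀ n m {i} → n ℕ.≤ i → degree i (varProduct n) m ≡ 0
degree-varProduct-≥ zero    m       n≤i = refl
degree-varProduct-≥ (suc n) (_ , m) n<i = cong₂ ℕ._+_ (δ-≢ (ℕ.<⇒≢ n<i)) (degree-varProduct-≥ n m (ℕ.<⇒≤ n<i))

degree-varProduct-< : ∀ n m {i} → i ℕ.< n → degree i (varProduct n) m ≡ 1
degree-varProduct-< (suc n) (_ , m) {i} i<1+n with ℕ.m≤n⇒m<n∨m≡n (ℕ.≤-pred i<1+n)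
... | inj₁ i<n  = cong₂ ℕ._+_ (δ-≢ (ℕ.>⇒≢ i<n)) (degree-varProduct-< n m i<n)
... | inj₂ refl = cong₂ ℕ._+_ (δ-refl n) (degree-varProduct-≥ n m ℕ.≤-refl)

-- The last vertex moves the exponent of xₙ₋₁ ⋯ x₀ to (1, ..., 1), the barycentre modulo `∼`.
degree-varProduct : ∀ n m {i} → i ℕ.≤ n → δ n i ℕ.+ degree i (varProduct n) m ≡ 1
degree-varProduct n m i≤n with ℕ.m≤n⇒m<n∨m≡n i≤n
... | inj₁ i<n  = cong₂ ℕ._+_ (δ-≢ (ℕ.>⇒≢ i<n)) (degree-varProduct-< n m i<n)
... | inj₂ refl = cong₂ ℕ._+_ (δ-refl n) (degree-varProduct-≥ n m ℕ.≤-refl)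

module _ (n : ℕ) where

  -- Coordinate `n` belongs to no variable of the inequality. Translation by this point sends `eₜ`
  -- to vertex `n`, and xₖ · b to vertex `k` plus (1, ..., 1).
  lastVertex : Point {suc n}
  lastVertex i = + δ n (toℕ i)

  lastVertex-fits : ∀ k → k ℕ.≤ n → Fits lastVertex (varMultiples k (varProduct n))
  lastVertex-fits zero    k≤n m = Fin.fromℕ n , + 0 , λ i →
    trans (ℤ.+-identityʳ _) (trans (cong (λ k → + δ k (toℕ i)) (sym (Fin.toℕ-fromℕ n))) (sym (ℤ.+-identityˡ _)))
  lastVertex-fits (suc k) k<n (inj₁ m) = lastVertex-fits k (ℕ.<⇒≤ k<n) m
  lastVertex-fits (suc k) k<n (inj₂ (_ , m)) = Fin.fromℕ< k<1+n , + 1 , λ i → cong +_ (begin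
    δ n (toℕ i) ℕ.+ (δ k (toℕ i) ℕ.+ degree (toℕ i) (varProduct n) m)  ≡⟨ swap (δ n (toℕ i)) (δ k (toℕ i)) _ ⟩
    δ n (toℕ i) ℕ.+ degree (toℕ i) (varProduct n) m ℕ.+ δ k (toℕ i)
      ≡⟨ cong₂ ℕ._+_ (degree-varProduct n m (Fin.toℕ≤pred[n] i))
                     (cong (λ k → δ k (toℕ i)) (sym (Fin.toℕ-fromℕ< k<1+n))) ⟩
    1 ℕ.+ δ (toℕ (Fin.fromℕ< k<1+n)) (toℕ i)                           ∎)
    where
    open ≡.≡-Reasoning
    k<1+n = ℕ.m≤n⇒m≤1+n k<n

    swap : ∀ a b c → a ℕ.+ (b ℕ.+ c) ≡ a ℕ.+ c ℕ.+ b
    swap a b c = trans (cong (a ℕ.+_) (ℕ.+-comm b c)) (sym (ℕ.+-assoc a c b))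

  -- The translate has all coordinates equal, whereas a vertex is not constant once there are two
  -- coordinates; `1 ≤ n` provides the second.
  lastVertex-misfits : 1 ℕ.≤ n → ¬ Fits lastVertex (varProduct n)
  lastVertex-misfits 1≤n fits with fits (someMonomial (varProduct n))
  ... | k , m , 1≡ = contradiction (trans (sym (δ-refl (toℕ k))) (trans δ-const (δ-≢ (k≢j ∘ Fin.toℕ-injective)))) λ ()
    where
    other : ∀ k → ∃[ j ] k ≢ j
    other zero    = Fin.fromℕ< (ℕ.s≤s 1≤n) , λ 0≡1 → ℕ.0≢1+n (trans (cong toℕ 0≡1) (Fin.toℕ-fromℕ< (ℕ.s≤s 1≤n)))
    other (suc _) = zero , λ ()

    j   = proj₁ (other k)
    k≢j = proj₂ (other k)

    one : ∀ i → + 1 ≡ m ℤ.+ + δ (toℕ k) (toℕ i)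
    one i = trans (sym (cong +_ (degree-varProduct n (someMonomial (varProduct n)) (Fin.toℕ≤pred[n] i)))) (1≡ i)

    δ-const : δ (toℕ k) (toℕ k) ≡ δ (toℕ k) (toℕ j)
    δ-const = ℤ.+-injective
      (GroupProperties.∙-cancelˡ (AbelianGroup.group ℤ.+-0-abelianGroup) m _ _ (trans (sym (one k)) (one j)))

  -- The quotient map itself refutes the equation: `lastVertex` fits `u` but not the join of `u`
  -- with the product.
  model-⊭ : 1 ℕ.≤ n → ∀ {c ℓ} → let u = varMultiples n (varProduct n) in
    ¬ (model {suc n} c ℓ ⊨ (u ∨ₜ varProduct n , u))
  model-⊭ 1≤n {c} {ℓ} holds = lastVertex-misfits 1≤n λ m →
    proj₂ (lower (holds quotient)) lastVertex (lastVertex-fits n ℕ.≤-refl) (inj₂ m)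
    where
    open L-Algebra (model {suc n} c ℓ) using (≈-equivalence)
    module ≈ = IsEquivalence ≈-equivalence
    quotient : Homomorphism termAlgebra (model c ℓ)
    quotient = record
      { ⟦_⟧ = lift
      ; isMonoidHomomorphism = record
        { isMagmaHomomorphism = record
          { isRelHomomorphism = record { cong = ≈.reflexive ∘ cong lift }
          ; homo = λ _ _ → ≈.refl }
        ; ε-homo = ≈.refl {lift eₜ} }
      ; ∨-homo = λ _ _ → ≈.refl }

-- Size of the model needed against a given finite basis.

monomialCount : Equation → ℕ
monomialCount (s , t) = length (monomials s) ℕ.⊔ length (monomials t)

theorem1 : ∀ {c ℓ k} (K : Pred (L-Algebra c ℓ) k) →
    (∀ A → K A → IsIdempotentSemifield A) →
    NonTrivial K →
    ¬ FinitelyBased K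
theorem1 {c} {ℓ} K semifields (A , A∈K , x , y , x≉y) (εs , basis) =
  model-⊭ n (⊥≤max 1 counts) (complete (model c ℓ) modelOfBasis (u ∨ₜ varProduct n , u) valid)
  where
  open IsBasis basis
  counts = map monomialCount εs
  -- The 1 secures `1 ≤ n` for `model-⊭`. All counts are at most `n`, hence below the number `suc n`
  -- of vertices.
  n = max 1 counts
  u = varMultiples n (varProduct n)

  modelOfBasis : ∀ ε → ε ∈ εs → model {suc n} c ℓ ⊨ ε
  modelOfBasis (s , t) ε∈εs = model-⊨ s t
    (Semifield.⊨⇒evalℤ-≡ (semifields A A∈K) x≉y (sound (s , t) ε∈εs A A∈K))
    (ℕ.s≤s (ℕ.≤-trans (ℕ.m≤m⊔n _ _) count≤n))
    (ℕ.s≤s (ℕ.≤-trans (ℕ.m≤n⊔m _ _) count≤n))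
    where
    count≤n : monomialCount (s , t) ℕ.≤ n
    count≤n = All.lookup (xs≤max 1 counts) (∈-map⁺ monomialCount ε∈εs)

  valid : Eq K (u ∨ₜ varProduct n , u)
  valid B B∈K hom = ≈-trans (∨-homo _ _) (≈-sym (varProduct≤varMultiples hom n))
    where
    open Semifield (semifields B B∈K)
    open Homomorphism hom
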